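{- Let $c$ be a constant with $0 < c < 1$. For graphs with odd girth $\Omega(n^c)$, there exists a deterministic online coloring algorithm that uses $O(\log n)$ colors. That is, for every constant $\alpha>0$ there exist constants $C$ and $n_0$ (depending only on $c$ and $\alpha$) such that for every $n\ge n_0$ there is a deterministic online coloring algorithm that uses at most $C\log n$ colors on every online input whose final graph has $n$ vertices and odd girth at least $\alpha n^c$.
   Context: Graphs are finite, simple and undirected. Online coloring problem: a graph $G=(V,E)$ is initially empty; vertices are added one by one, each together with its edges to previously added vertices. Immediately after a vertex $v$ is added, the algorithm must irrevocably assign a color $c(v)\in\mathbb{N}$ different from the colors of all neighbors of $v$; only then is the next vertex presented. The number of colors used is $|\{c(v): v\in V\}|$. The number $n$ of vertices of the final graph is assumed to be known to the algorithm in advance. The odd girth of a graph is the length of its shortest odd-length cycle, or $+\infty$ if there is none (equivalently, the length of its shortest odd-length closed walk). -}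

module Defs where

open import Data.Empty using (⊥)
open import Data.Fin using (Fin; zero; suc; toℕ)
open import Data.Fin.Subset using (Subset; _∈_)
open import Data.Integer using (+_)
open import Data.List using (length; tabulate; deduplicate)
open import Data.Nat using (ℕ; zero; suc; _*_; _≤_; NonZero; parity)
import Data.Nat as ℕ
open import Data.Parity.Base using (1ℙ)
open import Data.Product using (_×_; _,_; ∃-syntax)
open import Data.Rational using (ℚ; 0ℚ; 1ℚ; _/_; _<_; _+_; _-_; -_)
import Data.Rational.Properties as ℚ
open import Data.Sum using (_⊎_; inj₁; inj₂)
open import Data.Unit using (⊤)
open import Function using (Injective)
open import Relation.Binary.Definitions using (Symmetric; Irreflexive; tri<; tri≈; tri>)
open import Relation.Binary.PropositionalEquality using (_≡_; _≢_; refl; subst)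
open import Relation.Nullary using (¬_)
open import Relation.Nullary.Construct.Add.Supremum using (_⁺; [_]; ⊤⁺)

------------------------------------------------------------------------
-- Real numbers (two-sided Dedekind cuts)

record ℝ : Set₁ where
  field
    lower upper     : ℚ → Set
    lower-inhabited : ∃[ q ] lower q
    upper-inhabited : ∃[ q ] upper q
    lower-closed    : ∀ {p q} → p < q → lower q → lower p
    upper-closed    : ∀ {p q} → p < q → upper p → upper q
    lower-open      : ∀ {p} → lower p → ∃[ q ] p < q × lower q
    upper-open      : ∀ {q} → upper q → ∃[ p ] p < q × upper p
    disjoint        : ∀ {q} → lower q → ¬ upper q
    located         : ∀ {p q} → p < q → lower p ⊎ upper q

open ℝ

fromℚ : ℚ → ℝ
fromℚ x = record
  { lower           = λ q → q < x
  ; upper           = λ q → x < q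
  ; lower-inhabited = x - 1ℚ , x-1<x
  ; upper-inhabited = x + 1ℚ , x<x+1
  ; lower-closed    = ℚ.<-trans
  ; upper-closed    = λ p<q x<p → ℚ.<-trans x<p p<q
  ; lower-open      = λ p<x → let m , p<m , m<x = ℚ.<-dense p<x in m , p<m , m<x
  ; upper-open      = λ x<q → let m , x<m , m<q = ℚ.<-dense x<q in m , m<q , x<m
  ; disjoint        = ℚ.<-asym
  ; located         = locate
  }
  where
  x<x+1 : x < x + 1ℚ
  x<x+1 = subst (_< x + 1ℚ) (ℚ.+-identityʳ x)
            (ℚ.+-monoʳ-< x (ℚ.positive⁻¹ 1ℚ))

  x-1<x : x - 1ℚ < x
  x-1<x = subst (x - 1ℚ <_) (ℚ.+-identityʳ x)
            (ℚ.+-monoʳ-< x (ℚ.negative⁻¹ (- 1ℚ)))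

  locate : ∀ {p q} → p < q → p < x ⊎ x < q
  locate {p} p<q with ℚ.<-cmp p x
  ... | tri< p<x _ _    = inj₁ p<x
  ... | tri≈ _ refl _   = inj₂ p<q
  ... | tri> _ _ x<p    = inj₂ (ℚ.<-trans x<p p<q)

0ℝ 1ℝ : ℝ
0ℝ = fromℚ 0ℚ
1ℝ = fromℚ 1ℚ

infix 4 _<ℝ_
_<ℝ_ : ℝ → ℝ → Set
x <ℝ y = ∃[ q ] upper x q × lower y q

-- The real inequality  α · n^c ≤ g  for α, c > 0.  Since α · n^c is the
-- supremum of the numbers a · n^r over rationals 0 ≤ a < α and 0 < r < c, it
-- holds iff a · n^r ≤ g for all of them; with a = s / t and r = p / q, the
-- latter is cleared of denominators and of the q-th root.
infix 4 _·_^_≤ℕ_ _·_^_≤⁺_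
_·_^_≤ℕ_ : ℝ → ℕ → ℝ → ℕ → Set
α · n ^ c ≤ℕ g =
  ∀ (s t p q : ℕ) .{{_ : NonZero t}} .{{_ : NonZero p}} .{{_ : NonZero q}} →
  lower α (+ s / t) → lower c (+ p / q) →
  s ℕ.^ q * n ℕ.^ p ≤ (t * g) ℕ.^ q

_·_^_≤⁺_ : ℝ → ℕ → ℝ → ℕ ⁺ → Set
α · n ^ c ≤⁺ [ g ] = α · n ^ c ≤ℕ g
α · n ^ c ≤⁺ ⊤⁺    = ⊤

------------------------------------------------------------------------
-- Graphs and odd girth

record Graph (n : ℕ) : Set₁ where
  field
    Adj     : Fin n → Fin n → Set
    symm    : Symmetric Adj
    irrefl  : Irreflexive _≡_ Adj

record Cycle {n : ℕ} (G : Graph n) (ℓ : ℕ) : Set where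
  open Graph G
  field
    3≤ℓ       : 3 ≤ ℓ
    vertex    : Fin ℓ → Fin n
    injective : Injective _≡_ _≡_ vertex
    step      : ∀ {i j} → suc (toℕ i) ≡ toℕ j → Adj (vertex i) (vertex j)
    close     : ∀ {i j} → suc (toℕ i) ≡ ℓ → toℕ j ≡ 0 → Adj (vertex i) (vertex j)

Odd : ℕ → Set
Odd ℓ = parity ℓ ≡ 1ℙ

-- Odd girth takes values in ℕ ∪ {+∞}, with ⊤⁺ for +∞.
HasOddGirth : ∀ {n} → Graph n → ℕ ⁺ → Set
HasOddGirth G [ g ] = Cycle G g × Odd g × (∀ ℓ → Cycle G ℓ → Odd ℓ → g ≤ ℓ)
HasOddGirth G ⊤⁺    = ∀ ℓ → Cycle G ℓ → ¬ Odd ℓ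

------------------------------------------------------------------------
-- Online coloring

-- An online input: each new vertex comes with the set of its neighbors among
-- the earlier ones.  Vertices are indexed backwards in time: zero is the most
-- recently added vertex.
infixl 5 _▷_
data Input : ℕ → Set where
  ∅   : Input 0
  _▷_ : ∀ {t} → Input t → Subset t → Input (suc t)

InputAdj : ∀ {n} → Input n → Fin n → Fin n → Set
InputAdj (I ▷ N) zero    zero    = ⊥
InputAdj (I ▷ N) zero    (suc v) = v ∈ N
InputAdj (I ▷ N) (suc u) zero    = u ∈ N
InputAdj (I ▷ N) (suc u) (suc v) = InputAdj I u v

finalGraph : ∀ {n} → Input n → Graph n
finalGraph I = record
  { Adj    = InputAdj I
  ; symm   = λ {u} {v} → symm I u v
  ; irrefl = λ { {u} refl → irrefl I u }
  }
  where
  symm : ∀ {n} (I : Input n) u v → InputAdj I u v → InputAdj I v u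
  symm (I ▷ N) zero    (suc v) a = a
  symm (I ▷ N) (suc u) zero    a = a
  symm (I ▷ N) (suc u) (suc v) a = symm I u v a

  irrefl : ∀ {n} (I : Input n) u → ¬ InputAdj I u u
  irrefl (I ▷ N) (suc u) a = irrefl I u a

-- The color of a new vertex depends only on the input revealed so far.  The
-- earlier colors need not be passed along: a deterministic strategy can
-- recompute them from that input.
Strategy : Set
Strategy = ∀ {t} → Input t → Subset t → ℕ

coloring : Strategy → ∀ {n} → Input n → Fin n → ℕ
coloring σ (I ▷ N) zero    = σ I N
coloring σ (I ▷ N) (suc v) = coloring σ I v

record OnlineAlgorithm : Set where
  field
    strategy : Strategy
    proper   : ∀ {t} (I : Input t) (N : Subset t) {v} → v ∈ N →
               strategy I N ≢ coloring strategy I v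

numColors : ∀ {n} → (Fin n → ℕ) → ℕ
numColors f = length (deduplicate ℕ._≟_ (tabulate f))

colorsUsed : OnlineAlgorithm → ∀ {n} → Input n → ℕ
colorsUsed A I = numColors (coloring (OnlineAlgorithm.strategy A) I)

{-# OPTIONS --safe #-}

-- Vertices are clustered at scales ρ = 8^ℓ.  A vertex reaching level ℓ has at least M^ℓ vertices
-- within 8^ℓ of it.  It joins a center within 2ρ, or becomes a center itself, so that the ρ-balls
-- of the centers (taken at the time of their arrival) are disjoint.  If M centers lie within 5ρ of
-- its own center, then it goes on to level ℓ + 1, as its 8ρ-ball contains M disjoint balls of
-- size M^ℓ.  Otherwise it is colored by the level, a label of its cluster and the parity of a short
-- walk to its center.  Labels are chosen per cluster and number of near centers, avoiding those
-- used so far by near clusters; fewer than M centers are near and each cluster uses at most M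
-- labels, so M² labels suffice.  Adjacent vertices of one cluster have different parities, as
-- otherwise there were a closed odd walk of length at most 5ρ; adjacent vertices of different
-- clusters have near centers.  At most log n / log M + 1 levels occur, and their scales stay below
-- n^(3 / log₂ M), hence well below the odd girth for a suitable constant M.

module Submission where

open import Defs
open import Data.Bool using (Bool; true; T; if_then_else_)
open import Data.Bool.Properties using (T?)
open import Data.Empty using (⊥)
open import Data.Fin using (Fin; zero; suc; toℕ; fromℕ<; combine)
import Data.Fin as Fin
import Data.Fin.Properties as Fin
open import Data.Fin.Properties using (any?; injective⇒≤; combine-injective; suc-injective)
open import Data.Fin.Subset using (Subset) renaming (_∈_ to _∈ˢ_)
open import Data.Fin.Subset.Properties using (_∈?_)
import Data.Integer as ℤ
import Data.Integer.Properties as ℤ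
open import Data.List using (List; _∷_; length; lookup; map; filter; allFin; tabulate; deduplicate)
open import Data.List.Membership.Propositional using (_∈_)
open import Data.List.Membership.Propositional.Properties
  using (∈-map⁻; ∈-filter⁺; ∈-filter⁻; ∈-allFin; ∈-lookup; ∈-tabulate⁻; ∈-deduplicate⁻)
open import Data.List.Properties using (length-map)
open import Data.List.Relation.Unary.All as All using (All)
open import Data.List.Relation.Unary.AllPairs using (_∷_)
open import Data.List.Relation.Unary.Any as Any using (here; there)
open import Data.List.Relation.Unary.Any.Properties using (lookup-index)
open import Data.List.Relation.Unary.Unique.Propositional using (Unique)
open import Data.List.Relation.Unary.Unique.Propositional.Properties using (map⁺; filter⁺; allFin⁺)
open import Data.Maybe using (Maybe; just; nothing)
open import Data.Maybe.Properties using (≡-dec; just-injective)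
open import Data.Nat
open import Data.List.Relation.Unary.Unique.DecPropositional.Properties _≟_ using (deduplicate-!)
open import Data.Nat.DivMod
open import Data.Nat.Induction using (<-rec)
open import Data.Nat.Logarithm
open import Data.Nat.Properties hiding (suc-injective)
open import Data.Nat.Solver using (module +-*-Solver)
open +-*-Solver using (solve; con; _:+_; _:*_; _:=_)
open import Data.Parity.Base using (Parity; 0ℙ; 1ℙ)
import Data.Parity.Base as ℙ
import Data.Parity.Properties as ℙ
open import Data.Product using (∃; ∃-syntax; Σ-syntax; _×_; _,_; proj₁; proj₂)
import Data.Rational as ℚ
import Data.Rational.Properties as ℚ
open import Data.Rational using (0ℚ)
open import Data.Sum using (_⊎_; inj₁; inj₂)
open import Function using (Injective; _∘_)
open import Relation.Binary.Definitions using (Symmetric)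
open import Relation.Binary.PropositionalEquality
open import Relation.Nullary using (¬_; Dec; yes; no; contradiction)
open import Relation.Nullary.Construct.Add.Supremum using (_⁺; [_]; ⊤⁺)
open import Relation.Nullary.Decidable using (_×-dec_; ⌊_⌋; map′; ¬?; decidable-stable)

-- Counting with duplicate-free lists.

lookup-injective : ∀ {A : Set} {xs : List A} → Unique xs → Injective _≡_ _≡_ (lookup xs)
lookup-injective (x≢ ∷ u) {zero}  {zero}  _  = refl
lookup-injective {xs = _ ∷ xs} (x≢ ∷ u) {zero}  {suc j} eq =
  contradiction eq (All.lookup x≢ (∈-lookup {xs = xs} j))
lookup-injective {xs = _ ∷ xs} (x≢ ∷ u) {suc i} {zero}  eq =
  contradiction (sym eq) (All.lookup x≢ (∈-lookup {xs = xs} i))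
lookup-injective (x≢ ∷ u) {suc i} {suc j} eq = cong suc (lookup-injective u eq)

index-injective : ∀ {A : Set} {xs : List A} {x y : A} (p : x ∈ xs) (q : y ∈ xs) →
  Any.index p ≡ Any.index q → x ≡ y
index-injective {xs = xs} p q eq =
  trans (lookup-index p) (trans (cong (lookup xs) eq) (sym (lookup-index q)))

unique⊆⇒length≤ : ∀ {A : Set} {xs ys : List A} → Unique xs →
  (∀ {x} → x ∈ xs → x ∈ ys) → length xs ≤ length ys
unique⊆⇒length≤ {xs = xs} u sub = injective⇒≤ {f = λ i → Any.index (sub (∈-lookup {xs = xs} i))}
  (λ eq → lookup-injective u (index-injective _ _ eq))

_∈ˡ?_ : ∀ {n} (x : Fin n) xs → Dec (x ∈ xs)
x ∈ˡ? xs = Any.any? (x Fin.≟_) xs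

-- A missing `y` could be put in front of `xs`, giving a duplicate-free list inside `ys` that is too
-- long.
unique⊆∧length≥⇒⊇ : ∀ {n} {xs ys : List (Fin n)} → Unique xs →
  (∀ {x} → x ∈ xs → x ∈ ys) → length ys ≤ length xs → ∀ {y} → y ∈ ys → y ∈ xs
unique⊆∧length≥⇒⊇ {xs = xs} {ys} u sub len {y} y∈ys with y ∈ˡ? xs
... | yes y∈xs = y∈xs
... | no  y∉xs = contradiction (≤-trans (unique⊆⇒length≤ {ys = ys} (fresh ∷ u) sub′) len) (<-irrefl refl)
  where
  fresh : All (y ≢_) xs
  fresh = All.tabulate (λ { z∈xs refl → y∉xs z∈xs })
  sub′ : ∀ {x} → x ∈ y ∷ xs → x ∈ ys
  sub′ (here refl) = y∈ys
  sub′ (there p)   = sub p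

parity-cases : ∀ n → parity n ≡ 0ℙ ⊎ Odd n
parity-cases n with parity n
... | 0ℙ = inj₁ refl
... | 1ℙ = inj₂ refl

odd-+⇒ : ∀ a b → Odd (a + b) → Odd a ⊎ Odd b
odd-+⇒ a b o with parity-cases a
... | inj₂ oa = inj₁ oa
... | inj₁ ea = inj₂ (trans (sym (trans (ℙ.+-homo-+ a b) (cong (ℙ._+ parity b) ea))) o)

-- Walks

data Walk {t} (E : Fin t → Fin t → Set) : ℕ → Fin t → Fin t → Set where
  []  : ∀ {u} → Walk E 0 u u
  _∷_ : ∀ {k u v w} → E u v → Walk E k v w → Walk E (suc k) u w

module _ {t} {E : Fin t → Fin t → Set} where

  _++_ : ∀ {j k u v w} → Walk E j u v → Walk E k v w → Walk E (j + k) u w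
  []      ++ q = q
  (e ∷ p) ++ q = e ∷ (p ++ q)

  reverse : Symmetric E → ∀ {k u v} → Walk E k u v → Walk E k v u
  reverse s []                = []
  reverse s {u = u} {w} (_∷_ {k = k} e p) = subst (λ l → Walk E l w u) (+-comm k 1) (reverse s p ++ (s e ∷ []))

  walk? : (∀ u v → Dec (E u v)) → ∀ k u v → Dec (Walk E k u v)
  walk? E? zero    u v = map′ (λ { refl → [] }) (λ { [] → refl }) (u Fin.≟ v)
  walk? E? (suc k) u v = map′ (λ { (_ , e , p) → e ∷ p }) (λ { (e ∷ p) → _ , e , p })
    (any? (λ w → E? u w ×-dec walk? E? k w v))

  -- The source of the i-th edge. The end vertex is left out, so a closed walk lists its base only
  -- once and can be injective.
  start : ∀ {k u v} → Walk E k u v → Fin k → Fin t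
  start {u = u} (e ∷ p) zero    = u
  start         (e ∷ p) (suc i) = start p i

  start-zero : ∀ {k u v} (p : Walk E k u v) i → toℕ i ≡ 0 → start p i ≡ u
  start-zero (e ∷ p) zero _ = refl

  start-step : ∀ {k u v} (p : Walk E k u v) {i j} → suc (toℕ i) ≡ toℕ j → E (start p i) (start p j)
  start-step (e ∷ p) {zero}  {suc j} eq =
    subst (E _) (sym (start-zero p j (sym (cong pred eq)))) e
  start-step (e ∷ p) {suc i} {suc j} eq = start-step p (cong pred eq)

  start-last : ∀ {k u v} (p : Walk E k u v) {i} → suc (toℕ i) ≡ k → E (start p i) v
  start-last (e ∷ [])      {zero}  eq = e
  start-last (e ∷ (f ∷ p)) {suc i} eq = start-last (f ∷ p) (cong pred eq)

  -- Both `cycle` and `tail` are nonempty, so `cycle` and `head ++ tail` are each strictly shorter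
  -- than the whole walk.
  record Loop (k : ℕ) (u v : Fin t) : Set where
    constructor loop
    field
      {before inside after} : ℕ
      {base}    : Fin t
      head      : Walk E before u base
      cycle     : Walk E (suc inside) base base
      tail      : Walk E (suc after) base v
      total     : before + (suc inside + suc after) ≡ k

  split : ∀ {k u v} (p : Walk E k u v) i →
    ∃[ a ] ∃[ b ] Walk E a u (start p i) × Walk E (suc b) (start p i) v × a + suc b ≡ k
  split (e ∷ p) zero    = _ , _ , [] , e ∷ p , refl
  split (e ∷ p) (suc i) = let a , b , q , r , eq = split p i in suc a , b , e ∷ q , r , cong suc eq

  injective-or-loop : ∀ {k u v} (p : Walk E k u v) → Injective _≡_ _≡_ (start p) ⊎ Loop k u v
  injective-or-loop [] = inj₁ (λ { {()} })
  injective-or-loop {u = u} (e ∷ p) with any? (λ i → start p i Fin.≟ u)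
  ... | yes (i , refl) = let a , b , q , r , eq = split p i in
        inj₂ (loop [] (e ∷ q) r (cong suc eq))
  ... | no u∉p with injective-or-loop p
  ...   | inj₂ (loop q c r eq) = inj₂ (loop (e ∷ q) c r (cong suc eq))
  ...   | inj₁ inj = inj₁ inj′
    where
    inj′ : Injective _≡_ _≡_ (start (e ∷ p))
    inj′ {zero}  {zero}  eq = refl
    inj′ {zero}  {suc j} eq = contradiction (j , sym eq) u∉p
    inj′ {suc i} {zero}  eq = contradiction (i , eq) u∉p
    inj′ {suc i} {suc j} eq = cong suc (inj eq)

  -- Cutting at the repeated vertex gives two closed walks whose lengths add up to `k`, so one of
  -- them is odd.
  shorten : ∀ {k v} → Loop k v v → Odd k → ∃[ j ] ∃[ x ] j < k × Walk E j x x × Odd j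
  shorten (loop {x} {y} {z} q c r refl) o with odd-+⇒ (suc y) (x + suc z) (subst Odd rearrange o)
    where
    rearrange : x + (suc y + suc z) ≡ suc y + (x + suc z)
    rearrange = trans (sym (+-assoc x (suc y) (suc z)))
      (trans (cong (_+ suc z) (+-comm x (suc y))) (+-assoc (suc y) x (suc z)))
  ... | inj₁ oc = _ , _ , ≤-trans (m<m+n (suc y) z<s) (m≤n+m _ x) , c , oc
  ... | inj₂ oqr = _ , _ , +-monoʳ-< x (m<n+m (suc z) z<s) , q ++ r , oqr

odd-closed-walk⇒odd-cycle : ∀ {n} (G : Graph n) {k v} → Walk (Graph.Adj G) k v v → Odd k →
  ∃[ ℓ ] ℓ ≤ k × Cycle G ℓ × Odd ℓ
odd-closed-walk⇒odd-cycle {n} G {k} p o = go k ≤-refl p o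
  where
  open Graph G
  cycle : ∀ {k v} (p : Walk Adj k v v) → Odd k → Injective _≡_ _≡_ (start p) → Cycle G k
  -- Lengths 0 and 2 are excluded by parity, and length 1 would be a self-loop.
  cycle {1} (e ∷ []) o inj = contradiction e (irrefl refl)
  cycle {suc (suc (suc k))} p o inj = record
    { 3≤ℓ = s≤s (s≤s (s≤s z≤n)) ; vertex = start p ; injective = inj ; step = start-step p
    ; close = λ {i} {j} last first → subst (Adj (start p i)) (sym (start-zero p j first)) (start-last p last) }

  go : ∀ b {k v} → k ≤ b → Walk Adj k v v → Odd k → ∃[ ℓ ] ℓ ≤ k × Cycle G ℓ × Odd ℓ
  go zero    z≤n [] ()
  go (suc b) k≤b p o with injective-or-loop p
  ... | inj₁ inj = _ , ≤-refl , cycle p o inj , o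
  ... | inj₂ l = let j , x , j<k , q , oj = shorten l o
                     ℓ , ℓ≤ , C = go b (≤-pred (≤-trans j<k k≤b)) q oj
                 in ℓ , ≤-trans ℓ≤ (<⇒≤ j<k) , C

-- Online inputs

-- Evaluates `f` on the input as it stood when the vertex had just arrived, so later arrivals never
-- change the value.
at : ∀ {A : Set} → (∀ {t} → Input (suc t) → A) → ∀ {t} → Input t → Fin t → A
at f (I ▷ N) zero    = f (I ▷ N)
at f (I ▷ N) (suc v) = at f I v

adj? : ∀ {t} (I : Input t) u v → Dec (InputAdj I u v)
adj? (I ▷ N) zero    zero    = no (λ ())
adj? (I ▷ N) zero    (suc v) = v ∈? N
adj? (I ▷ N) (suc u) zero    = u ∈? N
adj? (I ▷ N) (suc u) (suc v) = adj? I u v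

liftWalk : ∀ {t} (I : Input t) {N k u v} →
  Walk (InputAdj I) k u v → Walk (InputAdj (I ▷ N)) k (suc u) (suc v)
liftWalk I []      = []
liftWalk I (e ∷ p) = e ∷ liftWalk I p

record Within {t} (I : Input t) (r : ℕ) (u v : Fin t) : Set where
  constructor within
  field
    {steps} : ℕ
    steps≤  : steps ≤ r
    walk    : Walk (InputAdj I) steps u v

within? : ∀ {t} (I : Input t) r u v → Dec (Within I r u v)
within? I r u v = map′ (λ (_ , k≤r , p) → within (≤-pred k≤r) p) (λ (within k≤r p) → _ , s≤s k≤r , p)
  (anyUpTo? (λ k → walk? (adj? I) k u v) (suc r))

within-refl : ∀ {t} {I : Input t} {r u} → Within I r u u
within-refl = within z≤n []

within-trans : ∀ {t} {I : Input t} {r s u v w} → Within I r u v → Within I s v w → Within I (r + s) u w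
within-trans (within j≤r p) (within k≤s q) = within (+-mono-≤ j≤r k≤s) (p ++ q)

within-sym : ∀ {t} {I : Input t} {r u v} → Within I r u v → Within I r v u
within-sym {I = I} (within k≤r p) = within k≤r (reverse (λ {u} {v} → Graph.symm (finalGraph I) {u} {v}) p)

within-mono : ∀ {t} {I : Input t} {r s u v} → r ≤ s → Within I r u v → Within I s u v
within-mono r≤s (within k≤r p) = within (≤-trans k≤r r≤s) p

within-lift : ∀ {t} {I : Input t} {N r u v} → Within I r u v → Within (I ▷ N) r (suc u) (suc v)
within-lift {I = I} (within k≤r p) = within k≤r (liftWalk I p)

-- w had arrived and was within r of v at the time v arrived.
BornWithin : ∀ {t} → Input t → ℕ → Fin t → Fin t → Set
BornWithin (I ▷ N) r zero    w       = Within (I ▷ N) r zero w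
BornWithin (I ▷ N) r (suc v) zero    = ⊥
BornWithin (I ▷ N) r (suc v) (suc w) = BornWithin I r v w

born⇒within : ∀ {t} (I : Input t) {r} v w → BornWithin I r v w → Within I r v w
born⇒within (I ▷ N) zero    w       p = p
born⇒within (I ▷ N) (suc v) (suc w) p = within-lift (born⇒within I v w p)

-- The form in which the odd girth is used: the clustering produces closed walks, and lifting them
-- lets the property pass to prefixes.
NoOddWalk : ∀ {t} → ℕ → Input t → Set
NoOddWalk b I = ∀ {k v} → k ≤ b → Walk (InputAdj I) k v v → ¬ Odd k

noOddWalk-prefix : ∀ {t b} {I : Input t} {N} → NoOddWalk b (I ▷ N) → NoOddWalk b I
noOddWalk-prefix {I = I} h k≤b p = h k≤b (liftWalk I p)

-- The scale is ρ, and m is the largest number of near centers of a vertex colored at this level.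
module Clustering (ρ m : ℕ) (1≤ρ : 1 ≤ ρ) (active : ∀ {t} → Input (suc t) → Bool) where

  -- Centers and their disjoint balls.

  Active : ∀ {t} → Input t → Fin t → Set
  Active I v = T (at active I v)

  chosen : ∀ {t} {P : Fin t → Set} → Dec (∃ P) → Fin (suc t)
  chosen (yes (z , _)) = suc z
  chosen (no _)        = zero

  mutual
    -- Every vertex gets a center, active or not, but by `IsCenter` only active vertices can be
    -- joined by others. Distances are those in the graph at arrival.
    center : ∀ {t} → Input t → Fin t → Fin t
    center (I ▷ N) (suc v) = suc (center I v)
    center (I ▷ N) zero    = chosen (centerInReach? I N)

    record IsCenter {t} (I : Input t) (z : Fin t) : Set where
      inductive; pattern
      constructor isCenter
      field
        isActive : Active I z
        self     : center I z ≡ z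

    isCenter? : ∀ {t} (I : Input t) z → Dec (IsCenter I z)
    isCenter? I z = map′ (λ (a , eq) → isCenter a eq) (λ (isCenter a eq) → a , eq)
      (T? _ ×-dec (center I z Fin.≟ z))

    centerInReach? : ∀ {t} (I : Input t) N →
      Dec (∃[ z ] IsCenter I z × Within (I ▷ N) (2 * ρ) zero (suc z))
    centerInReach? I N = any? (λ z → isCenter? I z ×-dec within? (I ▷ N) (2 * ρ) zero (suc z))

  isCenter-suc : ∀ {t} {I : Input t} {N z} → IsCenter I z → IsCenter (I ▷ N) (suc z)
  isCenter-suc (isCenter a eq) = isCenter a (cong suc eq)

  center-isCenter : ∀ {t} (I : Input t) v → Active I v → IsCenter I (center I v)
  center-isCenter (I ▷ N) (suc v) a = isCenter-suc (center-isCenter I v a)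
  center-isCenter (I ▷ N) zero    a with centerInReach? I N in eq
  ... | yes (z , c , _) = isCenter-suc c
  ... | no _            = isCenter a (cong chosen eq)

  center-within : ∀ {t} (I : Input t) v → Within I (2 * ρ) v (center I v)
  center-within (I ▷ N) (suc v) = within-lift (center-within I v)
  center-within (I ▷ N) zero with centerInReach? I N
  ... | yes (z , _ , w) = w
  ... | no _            = within-refl

  center-self : ∀ {t} {I : Input t} {N} → center (I ▷ N) zero ≡ zero →
    ∀ {z} → IsCenter I z → ¬ Within (I ▷ N) (2 * ρ) zero (suc z)
  center-self {I = I} {N} eq c w with centerInReach? I N
  ... | no ¬z = ¬z (_ , c , w)

  2ρ≡ : ρ + ρ ≡ 2 * ρ
  2ρ≡ = cong (ρ +_) (sym (+-identityʳ ρ))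

  -- A common vertex would put the earlier center within ρ + ρ of the later one on the arrival of
  -- the latter, which then would not have become its own center.
  centers-disjoint : ∀ {t} (I : Input t) {z z′ w} → IsCenter I z → IsCenter I z′ →
    BornWithin I ρ z w → BornWithin I ρ z′ w → z ≡ z′
  centers-disjoint (I ▷ N) {zero}  {zero}           c c′ p p′ = refl
  centers-disjoint (I ▷ N) {zero}  {suc z′} {suc w} (isCenter _ c) (isCenter a c′) p p′ =
    contradiction (subst (λ r → Within (I ▷ N) r zero (suc z′)) 2ρ≡
                     (within-trans p (within-sym (within-lift (born⇒within I z′ w p′)))))
                  (center-self c (isCenter a (suc-injective c′)))
  centers-disjoint (I ▷ N) {suc z} {zero}   {suc w} (isCenter a c) (isCenter _ c′) p p′ =
    contradiction (subst (λ r → Within (I ▷ N) r zero (suc z)) 2ρ≡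
                     (within-trans p′ (within-sym (within-lift (born⇒within I z w p)))))
                  (center-self c′ (isCenter a (suc-injective c)))
  centers-disjoint (I ▷ N) {suc z} {suc z′} {suc w} (isCenter a c) (isCenter a′ c′) p p′ =
    cong suc (centers-disjoint I (isCenter a (suc-injective c)) (isCenter a′ (suc-injective c′)) p p′)

  -- Near centers of a cluster.

  near? : ∀ {t} (I : Input t) v z → Dec (IsCenter I z × Within I (5 * ρ) (center I v) z)
  near? I v z = isCenter? I z ×-dec within? I (5 * ρ) (center I v) z

  -- Frozen when the vertex arrives: neither later centers nor later shortcuts enlarge the list.
  nearCenters : ∀ {t} → Input t → Fin t → List (Fin t)
  nearCenters (I ▷ N) zero    = filter (near? (I ▷ N) zero) (allFin _)
  nearCenters (I ▷ N) (suc v) = map suc (nearCenters I v)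

  degree : ∀ {t} → Input (suc t) → ℕ
  degree I = length (nearCenters I zero)

  -- At least `suc m` near centers; `suc m` is the M of the overview.
  crowded : ∀ {t} → Input (suc t) → Bool
  crowded I = m <ᵇ degree I

  crowded⇒ : ∀ {t} (I : Input t) v → T (at crowded I v) → m < at degree I v
  crowded⇒ (I ▷ N) zero    c = <ᵇ⇒< m _ c
  crowded⇒ (I ▷ N) (suc v) c = crowded⇒ I v c

  length-nearCenters : ∀ {t} (I : Input t) v → length (nearCenters I v) ≡ at degree I v
  length-nearCenters (I ▷ N) zero    = refl
  length-nearCenters (I ▷ N) (suc v) = trans (length-map Fin.suc (nearCenters I v)) (length-nearCenters I v)

  nearCenters-unique : ∀ {t} (I : Input t) v → Unique (nearCenters I v)
  nearCenters-unique (I ▷ N) zero    = filter⁺ (near? (I ▷ N) zero) (allFin⁺ _)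
  nearCenters-unique (I ▷ N) (suc v) = map⁺ suc-injective (nearCenters-unique I v)

  ∈-nearCenters⁻ : ∀ {t} (I : Input t) v {z} → z ∈ nearCenters I v →
    IsCenter I z × Within I (5 * ρ) (center I v) z
  ∈-nearCenters⁻ (I ▷ N) zero    p = proj₂ (∈-filter⁻ (near? (I ▷ N) zero) {xs = allFin _} p)
  ∈-nearCenters⁻ (I ▷ N) (suc v) p with ∈-map⁻ suc p
  ... | z , q , refl = let c , w = ∈-nearCenters⁻ I v q in isCenter-suc c , within-lift w

  ∈-nearCenters⁺ : ∀ {t} {I : Input (suc t)} {z} → IsCenter I z → Within I (5 * ρ) (center I zero) z →
    z ∈ nearCenters I zero
  ∈-nearCenters⁺ {I = I ▷ N} {z} c w = ∈-filter⁺ (near? (I ▷ N) zero) (∈-allFin z) (c , w)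

  -- Near sets of a cluster only grow, so equal sizes mean equal sets.
  nearCenters-constant : ∀ {t} (I : Input t) N v → center (I ▷ N) zero ≡ suc (center I v) →
    degree (I ▷ N) ≡ at degree I v →
    ∀ {z} → z ∈ nearCenters (I ▷ N) zero → z ∈ nearCenters (I ▷ N) (suc v)
  nearCenters-constant I N v same deg = unique⊆∧length≥⇒⊇ (nearCenters-unique (I ▷ N) (suc v)) sub
    (≤-reflexive (trans deg (sym (length-nearCenters (I ▷ N) (suc v)))))
    where
    sub : ∀ {x} → x ∈ nearCenters (I ▷ N) (suc v) → x ∈ nearCenters (I ▷ N) zero
    sub p = let c , w = ∈-nearCenters⁻ (I ▷ N) (suc v) p in
      ∈-nearCenters⁺ c (subst (λ z → Within (I ▷ N) (5 * ρ) z _) (sym same) w)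

  -- Labels of clusters.

  Settled : ∀ {t} → Input t → Fin t → Set
  Settled I v = Active I v × at degree I v ≤ m

  settled? : ∀ {t} (I : Input t) v → Dec (Settled I v)
  settled? I v = T? _ ×-dec (_ ≤? m)

  Label : Set
  Label = Fin (suc m * suc m)

  -- By nearCenters-constant, a twin saw the same near centers.
  Twin : ∀ {t} → Input t → Subset t → Fin t → Set
  Twin I N v = Settled I v × center (I ▷ N) zero ≡ suc (center I v) × degree (I ▷ N) ≡ at degree I v

  twin? : ∀ {t} (I : Input t) N → Dec (∃ (Twin I N))
  twin? I N = any? (λ v → settled? I v ×-dec (_ Fin.≟ _) ×-dec (_ ≟ _))

  mutual
    label : ∀ {t} → Input t → Fin t → Label
    label (I ▷ N) (suc v) = label I v
    label (I ▷ N) zero with twin? I N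
    ... | yes (v , _) = label I v
    ... | no _ with unused? I N
    ...   | yes (l , _) = l
    ...   | no _        = zero

    UsedNear : ∀ {t} → Input t → Subset t → Label → Set
    UsedNear I N l =
      ∃[ w ] Settled I w × suc (center I w) ∈ nearCenters (I ▷ N) zero × label I w ≡ l

    usedNear? : ∀ {t} (I : Input t) N l → Dec (UsedNear I N l)
    usedNear? I N l = any? (λ w → settled? I w ×-dec
      (suc (center I w) ∈ˡ? nearCenters (I ▷ N) zero) ×-dec (label I w Fin.≟ l))

    unused? : ∀ {t} (I : Input t) N → Dec (∃[ l ] ¬ UsedNear I N l)
    unused? I N = any? (λ l → ¬? (usedNear? I N l))

  -- The later vertex finds a twin, since the earlier one is such, and copies the label of the twin
  -- found. That label agrees with the one of the earlier vertex by induction.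
  label-determined : ∀ {t} (I : Input t) v w → Settled I v → Settled I w →
    center I v ≡ center I w → at degree I v ≡ at degree I w → label I v ≡ label I w
  label-new-determined : ∀ {t} (I : Input t) N w → Settled I w →
    center (I ▷ N) zero ≡ suc (center I w) → degree (I ▷ N) ≡ at degree I w →
    label (I ▷ N) zero ≡ label I w

  label-new-determined I N w sw ceq deq with twin? I N
  ... | yes (v , sv , ceq′ , deq′) = label-determined I v w sv sw
          (suc-injective (trans (sym ceq′) ceq)) (trans (sym deq′) deq)
  ... | no ¬twin = contradiction (w , sw , ceq , deq) ¬twin

  label-determined (I ▷ N) zero    zero    sv sw ceq deq = refl
  label-determined (I ▷ N) zero    (suc w) sv sw ceq deq = label-new-determined I N w sw ceq deq
  label-determined (I ▷ N) (suc v) zero    sv sw ceq deq =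
    sym (label-new-determined I N v sv (sym ceq) (sym deq))
  label-determined (I ▷ N) (suc v) (suc w) sv sw ceq deq =
    label-determined I v w sv sw (suc-injective ceq) deq

  -- A label used near is determined by a near center and a degree, hence there are at most
  -- m * suc m of them.
  unused-exists : ∀ {t} (I : Input t) N → degree (I ▷ N) ≤ m → ∃[ l ] ¬ UsedNear I N l
  unused-exists I N deg≤m with unused? I N
  ... | yes l = l
  ... | no ¬unused = contradiction (injective⇒≤ {f = code} code-injective)
          (<⇒≱ (*-monoˡ-< (suc m) (s≤s deg≤m)))
    where
    used : ∀ l → UsedNear I N l
    used l = decidable-stable (usedNear? I N l) (λ ¬u → ¬unused (l , ¬u))
    code : Label → Fin (degree (I ▷ N) * suc m)
    code l = let w , s , near , _ = used l in combine (Any.index near) (fromℕ< (s≤s (proj₂ s)))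
    code-injective : Injective _≡_ _≡_ code
    code-injective {l} {l′} eq =
      let w , s , near , e = used l
          w′ , s′ , near′ , e′ = used l′
          eqᶜ , eqᵈ = combine-injective (Any.index near) _ (Any.index near′) _ eq
      in trans (sym e) (trans (label-determined I w w′ s s′
           (suc-injective (index-injective near near′ eqᶜ))
           (Fin.fromℕ<-injective _ _ _ _ eqᵈ)) e′)

  -- Induction on arrivals. A fresh label avoids all labels used near. A copied one comes from a
  -- twin with the same near centers, to which the induction hypothesis applies.
  labels-differ : ∀ {t} (I : Input t) v w → Settled I v → Settled I w → center I v ≢ center I w →
    center I w ∈ nearCenters I v → label I v ≢ label I w
  label-new-differs : ∀ {t} (I : Input t) N w → Settled (I ▷ N) zero → Settled I w →
    center (I ▷ N) zero ≢ suc (center I w) →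
    suc (center I w) ∈ nearCenters (I ▷ N) zero → label (I ▷ N) zero ≢ label I w

  label-new-differs I N w sv sw c≢ near eq with twin? I N
  ... | yes (v , sv′ , ceq , deq) = labels-differ I v w sv′ sw (λ e → c≢ (trans ceq (cong suc e))) near′ eq
    where
    near′ : center I w ∈ nearCenters I v
    near′ with ∈-map⁻ suc (nearCenters-constant I N v ceq deq near)
    ... | _ , p , refl = p
  ... | no _ with unused? I N
  ...   | yes (l , ¬used) = ¬used (w , sw , near , sym eq)
  ...   | no ¬unused = ¬unused (unused-exists I N (proj₂ sv))

  labels-differ (I ▷ N) zero    zero    sv sw c≢ near = contradiction refl c≢
  labels-differ (I ▷ N) zero    (suc w) sv sw c≢ near = label-new-differs I N w sv sw c≢ near
  labels-differ (I ▷ N) (suc v) (suc w) sv sw c≢ near with ∈-map⁻ suc near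
  ... | _ , p , eq = labels-differ I v w sv sw (c≢ ∘ cong suc) (subst (_∈ nearCenters I v) (sym (suc-injective eq)) p)
  -- The earlier vertex saw the center of the later one. Being within 5ρ is symmetric and persists,
  -- so the later one also sees the center of the earlier one.
  labels-differ (I ▷ N) (suc v) zero    sv sw c≢ near =
    ≢-sym (label-new-differs I N v sw sv (≢-sym c≢) (∈-nearCenters⁺
      (center-isCenter (I ▷ N) (suc v) (proj₁ sv))
      (within-sym (proj₂ (∈-nearCenters⁻ (I ▷ N) (suc v) near)))))

  -- Parities of short walks to the center.

  evenToCenter? : ∀ {t} (I : Input (suc t)) → Dec (∃[ k ] k < suc (2 * ρ) × parity k ≡ 0ℙ ×
    Walk (InputAdj I) k zero (center I zero))
  evenToCenter? I = anyUpTo? (λ k → (parity k ℙ.≟ 0ℙ) ×-dec walk? (adj? I) k zero (center I zero)) _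

  -- Two walks to centers joined by an edge. The bound serves both for the distance between centers
  -- of adjacent vertices and for the closed walk inside one cluster.
  4ρ+1≤5ρ : 2 * ρ + (1 + 2 * ρ) ≤ 5 * ρ
  4ρ+1≤5ρ = ≤-trans (+-monoʳ-≤ (2 * ρ) (+-monoˡ-≤ (2 * ρ) 1≤ρ))
    (≤-reflexive (solve 1 (λ r → con 2 :* r :+ (r :+ con 2 :* r) := con 5 :* r) refl ρ))

  side : ∀ {t} → Input (suc t) → Parity
  side I = if ⌊ evenToCenter? I ⌋ then 0ℙ else 1ℙ

  -- If no short even walk exists, then the short walk given by `center-within` is odd.
  side-walk : ∀ {t} (I : Input t) v →
    ∃[ k ] k ≤ 2 * ρ × parity k ≡ at side I v × Walk (InputAdj I) k v (center I v)
  side-walk (I ▷ N) (suc v) = let k , k≤ , e , p = side-walk I v in k , k≤ , e , liftWalk I p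
  side-walk (I ▷ N) zero with evenToCenter? (I ▷ N)
  ... | yes (k , k≤ , e , p) = k , ≤-pred k≤ , e , p
  ... | no ¬even with center-within (I ▷ N) zero
  ...   | within {k} k≤ p with parity-cases k
  ...     | inj₁ e = contradiction (k , s≤s k≤ , e , p) ¬even
  ...     | inj₂ o = k , k≤ , o , p

  settled-proper : ∀ {t} (I : Input t) N u → NoOddWalk (5 * ρ) (I ▷ N) → u ∈ˢ N →
    Settled (I ▷ N) zero → Settled I u → label (I ▷ N) zero ≡ label I u →
    side (I ▷ N) ≢ at side I u
  settled-proper I N u noOdd u∈N sv su leq seq with center (I ▷ N) zero Fin.≟ suc (center I u)
  ... | no c≢ = label-new-differs I N u sv su c≢ (∈-nearCenters⁺ (center-isCenter (I ▷ N) (suc u) (proj₁ su)) close) leq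
    where
    close : Within (I ▷ N) (5 * ρ) (center (I ▷ N) zero) (suc (center I u))
    close = within-mono 4ρ+1≤5ρ (within-trans (within-sym (center-within (I ▷ N) zero))
      (within-trans {r = 1} (within ≤-refl (u∈N ∷ [])) (within-lift (center-within I u))))
  -- The closed walk runs from the new vertex to the common center, on to `u`, and back along the
  -- new edge. Equal sides make its length `j + (k + 1)` odd.
  ... | yes c≡ =
    let j , j≤ , je , p = side-walk (I ▷ N) zero
        k , k≤ , ke , q = side-walk I u
        q′ = reverse (λ {x} {y} → Graph.symm (finalGraph (I ▷ N)) {x} {y}) (liftWalk I q)
    in noOdd (≤-trans (+-mono-≤ j≤ (subst (_≤ 1 + 2 * ρ) (+-comm 1 k) (s≤s k≤))) 4ρ+1≤5ρ)
         (subst (Walk _ j zero) c≡ p ++ (q′ ++ (u∈N ∷ [])))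
         (odd-length j k (trans je (trans seq (sym ke))))
    where
    odd-length : ∀ j k → parity j ≡ parity k → Odd (j + (k + 1))
    odd-length j k e = trans (ℙ.+-homo-+ j (k + 1)) (trans (cong₂ ℙ._+_ e (ℙ.+-homo-+ k 1))
      (trans (sym (ℙ.+-assoc (parity k) (parity k) 1ℙ)) (cong (ℙ._+ 1ℙ) (ℙ.p+p≡0ℙ (parity k)))))

  -- Growth of balls around crowded vertices.

  HasBall : ∀ {t} → ℕ → ℕ → Input t → Fin t → Set
  HasBall {t} F r I v = Σ[ f ∈ (Fin F → Fin t) ] Injective _≡_ _≡_ f × (∀ i → BornWithin I r v (f i))

  lift-ball : ∀ {t F r} {I : Input t} {N v} → HasBall F r I v → HasBall F r (I ▷ N) (suc v)
  lift-ball (f , inj , w) = suc ∘ f , inj ∘ suc-injective , w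

  -- Unites the disjoint balls of `suc m` near centers. The radius adds up 2ρ to the own center, 5ρ
  -- to a near one and ρ inside its ball.
  crowded-ball : ∀ {F} → (∀ {t} (I : Input t) v → Active I v → HasBall F ρ I v) →
    ∀ {t} (I : Input t) v → T (at crowded I v) → HasBall (suc m * F) (8 * ρ) I v
  crowded-ball ball (I ▷ N) (suc v) c = lift-ball (crowded-ball ball I v c)
  crowded-ball {F} ball (I ▷ N) zero c = f , f-injective , f-within
    where
    I′ = I ▷ N
    deg : m < degree I′
    deg = crowded⇒ I′ zero c
    z : Fin (suc m) → Fin _
    z j = lookup (nearCenters I′ zero) (Fin.inject≤ j deg)
    z-injective : Injective _≡_ _≡_ z
    z-injective eq = Fin.inject≤-injective deg deg _ _ (lookup-injective (nearCenters-unique I′ zero) eq)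
    z-near : ∀ j → IsCenter I′ (z j) × Within I′ (5 * ρ) (center I′ zero) (z j)
    z-near j = ∈-nearCenters⁻ I′ zero (∈-lookup {xs = nearCenters I′ zero} _)
    z-ball : ∀ j → HasBall F ρ I′ (z j)
    z-ball j = ball I′ (z j) (IsCenter.isActive (proj₁ (z-near j)))
    g : Fin (suc m) × Fin F → Fin _
    g (j , i) = proj₁ (z-ball j) i
    g-injective : Injective _≡_ _≡_ g
    g-injective {j , i} {j′ , i′} eq with z-injective (centers-disjoint I′ (proj₁ (z-near j)) (proj₁ (z-near j′))
      (proj₂ (proj₂ (z-ball j)) i) (subst (BornWithin I′ ρ (z j′)) (sym eq) (proj₂ (proj₂ (z-ball j′)) i′)))
    ... | refl = cong (j ,_) (proj₁ (proj₂ (z-ball j)) eq)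
    f : Fin (suc m * F) → Fin _
    f x = g (Fin.remQuot F x)
    f-injective : Injective _≡_ _≡_ f
    f-injective {x} {y} eq = trans (sym (Fin.combine-remQuot {suc m} F x))
      (trans (cong (λ (j , i) → combine j i) (g-injective eq)) (Fin.combine-remQuot {suc m} F y))
    2ρ+5ρ+ρ≡8ρ : 2 * ρ + (5 * ρ + ρ) ≡ 8 * ρ
    2ρ+5ρ+ρ≡8ρ = solve 1 (λ r → con 2 :* r :+ (con 5 :* r :+ r) := con 8 :* r) refl ρ
    f-within : ∀ x → Within I′ (8 * ρ) zero (f x)
    f-within x = let j , i = Fin.remQuot F x in subst (λ r → Within I′ r zero (f x)) 2ρ+5ρ+ρ≡8ρ
      (within-trans (center-within I′ zero) (within-trans (proj₂ (z-near j))
        (born⇒within I′ (z j) (g (j , i)) (proj₂ (proj₂ (z-ball j)) i))))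

-- Strategies from partial ones

-- Colors from D on are used only if the partial strategy fails, which keeps the coloring proper on
-- every input.
module WithFallback (D : ℕ) (partial : ∀ {t} → Input (suc t) → Maybe (Fin D)) where

  Clash : ∀ {t} → Input t → Subset t → Fin D → Set
  Clash I N c = ∃[ v ] v ∈ˢ N × at partial I v ≡ just c

  clash? : ∀ {t} (I : Input t) N c → Dec (Clash I N c)
  clash? I N c = any? (λ v → (v ∈? N) ×-dec ≡-dec Fin._≟_ _ _)

  strategy : Strategy
  strategy {t} I N with partial (I ▷ N)
  ... | nothing = D + t
  ... | just c with clash? I N c
  ...   | yes _ = D + t
  ...   | no _  = toℕ c

  strategy< : ∀ {t} (I : Input t) N → strategy I N < D + suc t
  strategy< {t} I N with partial (I ▷ N)
  ... | nothing = +-monoʳ-< D ≤-refl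
  ... | just c with clash? I N c
  ...   | yes _ = +-monoʳ-< D ≤-refl
  ...   | no _  = m≤n⇒m≤n+o (suc t) (Fin.toℕ<n c)

  -- Makes `D + t` a fresh color for the vertex that arrives after `t` others.
  coloring< : ∀ {t} (I : Input t) v → coloring strategy I v < D + t
  coloring< (I ▷ N) zero    = strategy< I N
  coloring< (I ▷ N) (suc v) = ≤-trans (coloring< I v) (+-monoʳ-≤ D (n≤1+n _))

  -- Fallback colors are at least `D`, so a color below `D` stems from `partial`. Hence testing
  -- clashes against `partial` detects every repeated color.
  coloring-partial : ∀ {t} (I : Input t) v c → coloring strategy I v ≡ toℕ c → at partial I v ≡ just c
  coloring-partial (I ▷ N) (suc v) c eq = coloring-partial I v c eq
  coloring-partial (I ▷ N) zero    c eq with partial (I ▷ N)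
  ... | nothing = contradiction (subst (_< D) (sym eq) (Fin.toℕ<n c)) (≤⇒≯ (m≤m+n D _))
  ... | just c′ with clash? I N c′
  ...   | yes _ = contradiction (subst (_< D) (sym eq) (Fin.toℕ<n c)) (≤⇒≯ (m≤m+n D _))
  ...   | no _  = cong just (Fin.toℕ-injective eq)

  strategy-proper : ∀ {t} (I : Input t) N {v} → v ∈ˢ N → strategy I N ≢ coloring strategy I v
  strategy-proper {t} I N {v} v∈N eq with partial (I ▷ N)
  ... | nothing = <⇒≢ (coloring< I v) (sym eq)
  ... | just c with clash? I N c
  ...   | yes _     = <⇒≢ (coloring< I v) (sym eq)
  ...   | no ¬clash = ¬clash (v , v∈N , coloring-partial I v c (sym eq))

  algorithm : OnlineAlgorithm
  algorithm = record { strategy = strategy ; proper = strategy-proper }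

  strategy<D : ∀ {t} (I : Input t) N c → partial (I ▷ N) ≡ just c → ¬ Clash I N c → strategy I N < D
  strategy<D I N c eq ¬clash with partial (I ▷ N)
  strategy<D I N c refl ¬clash | just .c with clash? I N c
  ... | yes clash = contradiction clash ¬clash
  ... | no _      = Fin.toℕ<n c

numColors≤ : ∀ {n D} (f : Fin n → ℕ) → (∀ v → f v < D) → numColors f ≤ D
numColors≤ {D = D} f f<D = injective⇒≤ {f = λ i → fromℕ< (bound i)}
  (λ eq → lookup-injective (deduplicate-! (tabulate f)) (Fin.fromℕ<-injective _ _ _ _ eq))
  where
  colors = deduplicate _≟_ (tabulate f)
  bound : ∀ i → lookup colors i < D
  bound i with ∈-tabulate⁻ (∈-deduplicate⁻ _≟_ (tabulate f) (∈-lookup {xs = colors} i))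
  ... | v , eq = subst (_< D) (sym eq) (f<D v)

-- The hierarchy of clusterings

born-refl : ∀ {t} (I : Input t) {r} v → BornWithin I r v v
born-refl (I ▷ N) zero    = within-refl
born-refl (I ▷ N) (suc v) = born-refl I v

module Hierarchy (m k : ℕ) where

  active : ℕ → ∀ {t} → Input (suc t) → Bool
  active zero    I = true
  active (suc ℓ) I = Clustering.crowded (8 ^ ℓ) m (m^n>0 8 ℓ) (active ℓ) I

  module Level (ℓ : ℕ) = Clustering (8 ^ ℓ) m (m^n>0 8 ℓ) (active ℓ)
  open Level using (Settled; settled?)

  -- At level 0 the vertex alone suffices; each further level multiplies the size by `suc m` and the
  -- radius by 8.
  active-ball : ∀ ℓ {t} (I : Input t) v → Level.Active ℓ I v → Level.HasBall ℓ (suc m ^ ℓ) (8 ^ ℓ) I v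
  active-ball zero    I v _ = (λ _ → v) , (λ { {zero} {zero} _ → refl }) , (λ _ → born-refl I v)
  active-ball (suc ℓ) I v a = Level.crowded-ball ℓ (active-ball ℓ) I v a

  -- Descends to the highest active level below `j`. Being inactive one level above means not being
  -- crowded there, which bounds the degree.
  settles : ∀ {t} (I : Input t) N j → ¬ T (active j (I ▷ N)) → ∃[ ℓ ] ℓ < j × Settled ℓ (I ▷ N) zero
  settles I N zero    ¬a = contradiction _ ¬a
  settles I N (suc j) ¬a with T? (active j (I ▷ N))
  ... | yes a = j , ≤-refl , a , ≮⇒≥ (¬a ∘ <⇒<ᵇ)
  ... | no ¬a′ = let ℓ , ℓ<j , s = settles I N j ¬a′ in ℓ , m≤n⇒m≤1+n ℓ<j , s

  D : ℕ
  D = suc k * (suc m * suc m * 2)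

  parityIndex : Parity → Fin 2
  parityIndex 0ℙ = zero
  parityIndex 1ℙ = suc zero

  parityIndex-injective : Injective _≡_ _≡_ parityIndex
  parityIndex-injective {0ℙ} {0ℙ} _ = refl
  parityIndex-injective {1ℙ} {1ℙ} _ = refl

  encode : Fin (suc k) → Fin (suc m * suc m) → Parity → Fin D
  encode ℓ l p = combine ℓ (combine l (parityIndex p))

  encode-injective : ∀ {ℓ l p ℓ′ l′ p′} → encode ℓ l p ≡ encode ℓ′ l′ p′ → ℓ ≡ ℓ′ × l ≡ l′ × p ≡ p′
  encode-injective {ℓ} {l} {p} {ℓ′} {l′} {p′} eq =
    let eqℓ , eq′ = combine-injective ℓ _ ℓ′ _ eq
        eql , eqp = combine-injective l (parityIndex p) l′ (parityIndex p′) eq′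
    in eqℓ , eql , parityIndex-injective eqp

  colorOf : ∀ {t} → Fin (suc k) → Input t → Fin t → Fin D
  colorOf ℓ I v = encode ℓ (Level.label (toℕ ℓ) I v) (at (Level.side (toℕ ℓ)) I v)

  settledLevel? : ∀ {t} (I : Input (suc t)) → Dec (∃[ ℓ ] Settled (toℕ {suc k} ℓ) I zero)
  settledLevel? I = any? (λ ℓ → settled? (toℕ ℓ) I zero)

  -- A separate function, as with-abstraction would unfold the whole hierarchy in the proofs below.
  partialFrom : ∀ {t} (I : Input (suc t)) → Dec (∃[ ℓ ] Settled (toℕ {suc k} ℓ) I zero) → Maybe (Fin D)
  partialFrom I (yes (ℓ , _)) = just (colorOf ℓ I zero)
  partialFrom I (no _)        = nothing

  partialFrom-settled : ∀ {t} (I : Input (suc t)) d {c} → partialFrom I d ≡ just c →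
    ∃[ ℓ ] Settled (toℕ ℓ) I zero × c ≡ colorOf ℓ I zero
  partialFrom-settled I (yes (ℓ , s)) eq = ℓ , s , sym (just-injective eq)

  partialFrom-defined : ∀ {t} (I : Input (suc t)) d → ∃[ ℓ ] Settled (toℕ {suc k} ℓ) I zero →
    ∃[ c ] partialFrom I d ≡ just c
  partialFrom-defined I (yes (ℓ , _)) _ = colorOf ℓ I zero , refl
  partialFrom-defined I (no ¬s)       s = contradiction s ¬s

  partial : ∀ {t} → Input (suc t) → Maybe (Fin D)
  partial I = partialFrom I (settledLevel? I)

  open WithFallback D partial using (strategy; strategy<D; Clash; algorithm) public

  partial-settled : ∀ {t} (I : Input t) v {c} → at partial I v ≡ just c →
    ∃[ ℓ ] Settled (toℕ ℓ) I v × c ≡ colorOf ℓ I v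
  partial-settled (I ▷ N) zero    eq = partialFrom-settled (I ▷ N) (settledLevel? (I ▷ N)) eq
  partial-settled (I ▷ N) (suc v) eq = partial-settled I v eq

  still-active⇒large : ∀ {t} (I : Input (suc t)) → T (active (suc k) I) → suc m ^ suc k ≤ suc t
  still-active⇒large (I ▷ N) a = ball-size (active-ball (suc k) (I ▷ N) zero a)
    where
    ball-size : Level.HasBall (suc k) (suc m ^ suc k) (8 ^ suc k) (I ▷ N) zero → suc m ^ suc k ≤ _
    ball-size (f , f-injective , _) = injective⇒≤ {f = f} f-injective

  settles-below : ∀ {t} (I : Input t) N → suc t < suc m ^ suc k → ∃[ ℓ ] Settled (toℕ {suc k} ℓ) (I ▷ N) zero
  settles-below I N small = index (settles I N (suc k) (λ a → <⇒≱ small (still-active⇒large (I ▷ N) a)))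
    where
    index : ∃[ ℓ ] ℓ < suc k × Settled ℓ (I ▷ N) zero → ∃[ ℓ ] Settled (toℕ {suc k} ℓ) (I ▷ N) zero
    index (ℓ , ℓ<L , s) =
      fromℕ< ℓ<L , subst (λ ℓ → Settled ℓ (I ▷ N) zero) (sym (Fin.toℕ-fromℕ< ℓ<L)) s

  partial-defined : ∀ {t} (I : Input t) N → suc t < suc m ^ suc k → ∃[ c ] partial (I ▷ N) ≡ just c
  partial-defined I N small = partialFrom-defined (I ▷ N) (settledLevel? (I ▷ N)) (settles-below I N small)

  -- The code records the level, so equal colors reduce to `settled-proper` at one level, whose
  -- scale is at most `8 ^ k`.
  settled-colors-differ : ∀ {t} (I : Input t) N u → NoOddWalk (5 * 8 ^ k) (I ▷ N) → u ∈ˢ N → ∀ ℓ ℓ′ →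
    Settled (toℕ ℓ) (I ▷ N) zero → Settled (toℕ ℓ′) I u → colorOf ℓ (I ▷ N) zero ≢ colorOf ℓ′ I u
  settled-colors-differ I N u noOdd u∈N ℓ ℓ′ sv su eq = differ ℓ′ su
    (encode-injective {ℓ} {_} {Level.side (toℕ ℓ) (I ▷ N)} {ℓ′} {_} {at (Level.side (toℕ ℓ′)) I u} eq)
    where
    differ : ∀ ℓ′ → Settled (toℕ ℓ′) I u →
      ¬ (ℓ ≡ ℓ′ × Level.label (toℕ ℓ) (I ▷ N) zero ≡ Level.label (toℕ ℓ′) I u ×
         Level.side (toℕ ℓ) (I ▷ N) ≡ at (Level.side (toℕ ℓ′)) I u)
    differ .ℓ su (refl , leq , seq) = Level.settled-proper (toℕ ℓ) I N u
      (λ b → noOdd (≤-trans b (*-monoʳ-≤ 5 (^-monoʳ-≤ 8 (Fin.toℕ≤pred[n] ℓ))))) u∈N sv su leq seq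

  no-clash : ∀ {t} (I : Input t) N {c} → NoOddWalk (5 * 8 ^ k) (I ▷ N) → partial (I ▷ N) ≡ just c →
    ¬ Clash I N c
  no-clash I N {c} noOdd eq (u , u∈N , eq′) =
    clash⇒⊥ (partial-settled (I ▷ N) zero eq) (partial-settled I u eq′)
    where
    clash⇒⊥ : ∃[ ℓ ] Settled (toℕ ℓ) (I ▷ N) zero × c ≡ colorOf ℓ (I ▷ N) zero →
              ¬ (∃[ ℓ ] Settled (toℕ ℓ) I u × c ≡ colorOf ℓ I u)
    clash⇒⊥ (ℓ , sv , ceq) (ℓ′ , su , ceq′) =
      settled-colors-differ I N u noOdd u∈N ℓ ℓ′ sv su (trans (sym ceq) ceq′)

  -- The size bound makes `partial` defined on every arrival and the walk bound rules out clashes,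
  -- so the fallback never occurs.
  coloring<D : ∀ {t} (I : Input t) → t < suc m ^ suc k → NoOddWalk (5 * 8 ^ k) I →
    ∀ v → coloring strategy I v < D
  coloring<D (I ▷ N) small noOdd zero =
    let c , eq = partial-defined I N small in strategy<D I N c eq (no-clash I N noOdd eq)
  coloring<D (I ▷ N) small noOdd (suc v) =
    coloring<D I (<-trans ≤-refl small) (noOddWalk-prefix {N = N} noOdd) v

-- Choice of the parameters

⌊log₂⌋-lower : ∀ n → 0 < n → 2 ^ ⌊log₂ n ⌋ ≤ n
⌊log₂⌋-lower = <-rec _ go
  where
  go : ∀ n → (∀ {j} → j < n → 0 < j → 2 ^ ⌊log₂ j ⌋ ≤ j) → 0 < n → 2 ^ ⌊log₂ n ⌋ ≤ n
  go 1 rec _ = ≤-refl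
  go n@(suc (suc n′)) rec _ = begin
    2 ^ ⌊log₂ n ⌋                 ≡⟨ cong (2 ^_) (m+[n∸m]≡n {1} (⌊log₂⌋-mono-≤ {2} {n} (s≤s (s≤s z≤n)))) ⟨
    2 * 2 ^ (⌊log₂ n ⌋ ∸ 1)       ≡⟨ cong (λ l → 2 * 2 ^ l) (⌊log₂⌊n/2⌋⌋≡⌊log₂n⌋∸1 n) ⟨
    2 * 2 ^ ⌊log₂ ⌊ n /2⌋ ⌋       ≤⟨ *-monoʳ-≤ 2 (rec (⌊n/2⌋<n (suc n′)) z<s) ⟩
    2 * ⌊ n /2⌋                   ≡⟨ cong (⌊ n /2⌋ +_) (+-identityʳ _) ⟩
    ⌊ n /2⌋ + ⌊ n /2⌋             ≤⟨ +-monoʳ-≤ ⌊ n /2⌋ (⌊n/2⌋≤⌈n/2⌉ n) ⟩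
    ⌊ n /2⌋ + ⌈ n /2⌉             ≡⟨ ⌊n/2⌋+⌈n/2⌉≡n n ⟩
    n                             ∎
    where open ≤-Reasoning

⌊log₂⌋-upper : ∀ n → n < 2 ^ suc ⌊log₂ n ⌋
⌊log₂⌋-upper n = ≰⇒> (λ le → <-irrefl refl
  (≤-trans (≤-reflexive (sym (⌊log₂[2^n]⌋≡n (suc ⌊log₂ n ⌋)))) (⌊log₂⌋-mono-≤ le)))

n<8^n : ∀ n → n < 8 ^ n
n<8^n zero    = z<s
n<8^n (suc n) = ≤-trans (+-mono-≤ (m^n>0 8 n) (n<8^n n)) (+-monoʳ-≤ (8 ^ n) (m≤m+n (8 ^ n) _))

-- Rounding the quotient up gives an exponent of 2 that exceeds the logarithm, so no vertex stays
-- active beyond the last level.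
n<levels : ∀ n e .{{_ : NonZero e}} → n < suc (2 ^ e) ^ suc (⌊log₂ n ⌋ / e)
n<levels n e = begin-strict
  n                               <⟨ ⌊log₂⌋-upper n ⟩
  2 ^ suc L                       ≤⟨ ^-monoʳ-≤ 2 exponent ⟩
  2 ^ (e * suc (L / e))           ≡⟨ ^-*-assoc 2 e (suc (L / e)) ⟨
  (2 ^ e) ^ suc (L / e)           ≤⟨ ^-monoˡ-≤ (suc (L / e)) (n≤1+n (2 ^ e)) ⟩
  suc (2 ^ e) ^ suc (L / e)       ∎
  where
  open ≤-Reasoning
  L = ⌊log₂ n ⌋
  exponent : suc L ≤ e * suc (L / e)
  exponent = begin
    suc L                    ≡⟨ cong suc (m≡m%n+[m/n]*n L e) ⟩
    suc (L % e) + L / e * e  ≤⟨ +-monoˡ-≤ _ (m%n<n L e) ⟩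
    suc (L / e) * e          ≡⟨ *-comm (suc (L / e)) e ⟩
    e * suc (L / e)          ∎

-- As 8 = 2 ^ 3, dividing the logarithm by 6q = 3 · 2q keeps the largest scale below the 2q-th root
-- of `n`, so that its square can be compared with the girth.
radius-bound : ∀ n q .{{_ : NonZero (6 * q)}} → 0 < n → (8 ^ (⌊log₂ n ⌋ / (6 * q))) ^ (2 * q) ≤ n
radius-bound n q 0<n = begin
  ((2 ^ 3) ^ k) ^ (2 * q)   ≡⟨ ^-*-assoc (2 ^ 3) k (2 * q) ⟩
  (2 ^ 3) ^ (k * (2 * q))   ≡⟨ ^-*-assoc 2 3 (k * (2 * q)) ⟩
  2 ^ (3 * (k * (2 * q)))   ≡⟨ cong (2 ^_) (solve 2 (λ k q → con 3 :* (k :* (con 2 :* q)) := k :* (con 6 :* q)) refl k q) ⟩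
  2 ^ (k * (6 * q))         ≤⟨ ^-monoʳ-≤ 2 (m/n*n≤m ⌊log₂ n ⌋ (6 * q)) ⟩
  2 ^ ⌊log₂ n ⌋             ≤⟨ ⌊log₂⌋-lower n 0<n ⟩
  n                         ∎
  where
  open ≤-Reasoning
  k = ⌊log₂ n ⌋ / (6 * q)

-- From X² ≤ t g and 5 t < X.
radius<girth : ∀ {n g X} s t p q .{{_ : NonZero s}} .{{_ : NonZero p}} .{{_ : NonZero q}} →
  0 < n → X ^ (2 * q) ≤ n → s ^ q * n ^ p ≤ (t * g) ^ q → 5 * t < X → 5 * X < g
radius<girth {n} {g} {X} s t p@(suc p-1) q 0<n X≤n n≤g 5t<X = ≰⇒> (λ g≤5X → <⇒≱ (tg<X² g≤5X) X²≤tg)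
  where
  open ≤-Reasoning
  instance
    n≢0 : NonZero n
    n≢0 = >-nonZero 0<n
  X²≤tg : X ^ 2 ≤ t * g
  X²≤tg = ≮⇒≥ (λ lt → <⇒≱ (^-monoˡ-< q lt) (begin
    (X ^ 2) ^ q     ≡⟨ ^-*-assoc X 2 q ⟩
    X ^ (2 * q)     ≤⟨ X≤n ⟩
    n               ≤⟨ m≤m*n n (n ^ p-1) {{m^n≢0 n p-1}} ⟩
    n ^ p           ≤⟨ m≤n*m (n ^ p) (s ^ q) {{m^n≢0 s q}} ⟩
    s ^ q * n ^ p   ≤⟨ n≤g ⟩
    (t * g) ^ q     ∎))
  instance
    X≢0 : NonZero X
    X≢0 = >-nonZero (≤-trans z<s 5t<X)
  tg<X² : g ≤ 5 * X → t * g < X ^ 2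
  tg<X² g≤5X = begin-strict
    t * g        ≤⟨ *-monoʳ-≤ t g≤5X ⟩
    t * (5 * X)  ≡⟨ solve 2 (λ t x → t :* (con 5 :* x) := (con 5 :* t) :* x) refl t X ⟩
    5 * t * X    <⟨ *-monoˡ-< X 5t<X ⟩
    X * X        ≡⟨ cong (X *_) (*-identityʳ X) ⟨
    X ^ 2        ∎

-- Brings a rational witness of positivity into the form of the fractions in `_·_^_≤ℕ_`, with
-- nonzero numerator.
positive-fraction : ∀ {r} → 0ℚ ℚ.< r → ∃[ a ] ∃[ b ] ((ℤ.+ suc a) ℚ./ suc b) ≡ r
positive-fraction {r@(ℚ.mkℚ ℤ.+[1+ a ] b _)} 0<r = a , b , ℚ.↥p/↧p≡p r
positive-fraction {ℚ.mkℚ (ℤ.+ 0) b _} (ℚ.*<* 0<r) = contradiction 0<r (ℤ.<-irrefl refl)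
positive-fraction {ℚ.mkℚ ℤ.-[1+ a ] b _} (ℚ.*<* ())

noOddWalk : ∀ {n b} (I : Input n) γ → HasOddGirth (finalGraph I) γ →
  (∀ g → γ ≡ [ g ] → b < g) → NoOddWalk b I
noOddWalk I γ girth b<γ k≤b p o with odd-closed-walk⇒odd-cycle (finalGraph I) p o
noOddWalk I ⊤⁺    girth b<γ k≤b p o | ℓ , ℓ≤k , C , oℓ = girth ℓ C oℓ
noOddWalk I [ g ] (_ , _ , least) b<γ k≤b p o | ℓ , ℓ≤k , C , oℓ =
  <⇒≱ (b<γ g refl) (≤-trans (least ℓ C oℓ) (≤-trans ℓ≤k k≤b))

-- The parameters are variables here: with literal successors, 2 ^ (6 * q) would unfold.
log-colors : ∀ c α s t p q .{{_ : NonZero s}} .{{_ : NonZero t}} .{{_ : NonZero p}} .{{_ : NonZero q}} →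
  ℝ.lower α (ℤ.+ s ℚ./ t) → ℝ.lower c (ℤ.+ p ℚ./ q) →
  ∃[ C ] ∃[ n₀ ] ((n : ℕ) → n₀ ≤ n →
    Σ[ A ∈ OnlineAlgorithm ] ((I : Input n) (γ : ℕ ⁺) →
      HasOddGirth (finalGraph I) γ → α · n ^ c ≤⁺ γ → colorsUsed A I ≤ C * ⌊log₂ n ⌋))
-- The threshold gives `5 * t ≤ k`, hence `5 * t < 8 ^ k`. The factor 2 absorbs `suc k ≤ L + L`.
log-colors c α s t p q s/t<α p/q<c = 2 * colorsPerLevel , 2 ^ (5 * t * e) , online
  where
  e m colorsPerLevel : ℕ
  e = 6 * q
  m = 2 ^ e
  colorsPerLevel = suc m * suc m * 2
  instance
    e≢0 : NonZero e
    e≢0 = m*n≢0 6 q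
  online : ∀ n → 2 ^ (5 * t * e) ≤ n → Σ[ A ∈ OnlineAlgorithm ] ((I : Input n) (γ : ℕ ⁺) →
    HasOddGirth (finalGraph I) γ → α · n ^ c ≤⁺ γ → colorsUsed A I ≤ 2 * colorsPerLevel * ⌊log₂ n ⌋)
  online n n₀≤n = algorithm , bound
    where
    open ≤-Reasoning
    L k : ℕ
    L = ⌊log₂ n ⌋
    k = L / e
    open Hierarchy m k
    0<n : 0 < n
    0<n = ≤-trans (m^n>0 2 (5 * t * e)) n₀≤n
    5te≤L : 5 * t * e ≤ L
    5te≤L = ≤-trans (≤-reflexive (sym (⌊log₂[2^n]⌋≡n (5 * t * e)))) (⌊log₂⌋-mono-≤ n₀≤n)
    5t≤k : 5 * t ≤ k
    5t≤k = ≤-trans (≤-reflexive (sym (m*n/n≡m (5 * t) e))) (/-monoˡ-≤ e 5te≤L)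
    1≤5te : 1 ≤ 5 * t * e
    1≤5te = >-nonZero⁻¹ _ {{m*n≢0 (5 * t) e {{m*n≢0 5 t}}}}
    D≤ : D ≤ 2 * colorsPerLevel * L
    D≤ = begin
      suc k * colorsPerLevel   ≤⟨ *-monoˡ-≤ colorsPerLevel (+-mono-≤ (≤-trans 1≤5te 5te≤L) (m/n≤m L e)) ⟩
      (L + L) * colorsPerLevel ≡⟨ solve 2 (λ l d → (l :+ l) :* d := con 2 :* d :* l) refl L colorsPerLevel ⟩
      2 * colorsPerLevel * L   ∎
    radius<γ : ∀ γ → α · n ^ c ≤⁺ γ → ∀ g → γ ≡ [ g ] → 5 * 8 ^ k < g
    radius<γ _ αn^c≤γ g refl = radius<girth s t p q 0<n (radius-bound n q 0<n)
      (αn^c≤γ s t p q s/t<α p/q<c) (≤-trans (s≤s 5t≤k) (n<8^n k))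
    bound : (I : Input n) (γ : ℕ ⁺) → HasOddGirth (finalGraph I) γ → α · n ^ c ≤⁺ γ →
      colorsUsed algorithm I ≤ 2 * colorsPerLevel * L
    bound I γ girth αn^c≤γ = ≤-trans
      (numColors≤ (coloring strategy I)
        (coloring<D I (n<levels n e) (noOddWalk I γ girth (radius<γ γ αn^c≤γ))))
      D≤

corollary24 : (c : ℝ) → 0ℝ <ℝ c → c <ℝ 1ℝ →
    (α : ℝ) → 0ℝ <ℝ α →
    ∃[ C ] ∃[ n₀ ] ((n : ℕ) → n₀ ≤ n →
    Σ[ A ∈ OnlineAlgorithm ] ((I : Input n) (γ : ℕ ⁺) →
    HasOddGirth (finalGraph I) γ → α · n ^ c ≤⁺ γ →
    colorsUsed A I ≤ C * ⌊log₂ n ⌋))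
corollary24 c (x , 0<x , x<c) _ α (y , 0<y , y<α) =
  -- The witnesses of 0 < c and 0 < α become fractions below `c` and `α`, which select one instance
  -- of the girth hypothesis.
  let p , q , p/q≡x = positive-fraction 0<x
      s , t , s/t≡y = positive-fraction 0<y
  in log-colors c α (suc s) (suc t) (suc p) (suc q)
       (subst (ℝ.lower α) (sym s/t≡y) y<α) (subst (ℝ.lower c) (sym p/q≡x) x<c)
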